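{- Let $X$ be any abelian group with a translation-invariant metric $d_X$, and let $\alpha\in X$, with strict best-return denominators $q_1<q_2<\cdots$ (a finite or infinite sequence). Suppose that an integer $M\ge1$ satisfies $$q_{n+M}\ge2q_n$$ for every $n\ge1$ for which $q_{n+M}$ exists. Then $g_N(\alpha)\le M+1$ for every integer $N\ge2$. In particular, the conclusion holds under the stronger hypothesis that $q_{n+M}\ge q_n+q_{n+1}$ for every $n\ge 1$ for which $q_{n+M}$ exists.
   Context: Best returns. For positive integers $q$ put $\rho(q)=d_X(q\alpha,0)$. The strict best-return denominators of $\alpha$ are $q_1=1$ and $q_{n+1}=\min\{q>q_n:\rho(q)<\rho(q_n)\}$ as long as such $q$ exists; the sequence may terminate, and a zero return (if any) is retained as its final term. Nearest-neighbour distances. For $N\ge2$ let $\mathcal O_N(\alpha)=\{0,\alpha,\dots,(N-1)\alpha\}$ as a set (repetitions discarded). If it has at least two points put $\delta_N(x)=\min_{y\in\mathcal O_N(\alpha),\,y\ne x}d_X(x,y)$ and $g_N(\alpha)=\#\{\delta_N(x):x\in\mathcal O_N(\alpha)\}$; if it is a singleton, $g_N(\alpha)=0$. -}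

module Defs where

open import Algebra.Bundles using (AbelianGroup)
open import Axiom.ExcludedMiddle using (ExcludedMiddle)
open import Data.List.Base using (List; []; _∷_; deduplicate; filter; length; map; mapMaybe; upTo)
open import Data.Maybe.Base using (Maybe; just; nothing)
open import Data.Nat.Base as ℕ using (ℕ; suc)
open import Data.Product.Base using (∃; _×_; _,_; proj₁; proj₂)
open import Data.Rational.Base as ℚ using (ℚ; 0ℚ; 1ℚ)
import Data.Rational.Properties as ℚ
open import Data.Sum.Base using (inj₁; inj₂)
open import Function.Base using (id; _∘_)
open import Function.Metric.Definitions using (TranslationInvariant)
open import Function.Metric.Structures using (IsGeneralMetric)
open import Level using (0ℓ; _⊔_) renaming (suc to lsuc)
open import Relation.Binary.Bundles using (TotalOrder)
open import Relation.Binary.Definitions using (Decidable; Total; tri<; tri≈; tri>)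
open import Relation.Binary.PropositionalEquality
  using (_≡_; refl; sym; subst; cong; module ≡-Reasoning)
open import Relation.Binary.Structures using (IsEquivalence; IsPartialOrder; IsTotalOrder)
open import Relation.Nullary using (¬_; yes; no; contradiction)
open import Relation.Nullary.Decidable using (map′; ¬?)
open import Relation.Unary using (Pred; _⊆_; Satisfiable)
import Algebra.Definitions.RawMonoid as RawMonoid
import Data.List.Extrema as Extrema
import Relation.Binary.Construct.NonStrictToStrict as NonStrictToStrict

-- Real numbers as classical Dedekind cuts, represented by their lower part:
-- a nonempty proper down-closed set of rationals without a largest element.
-- Under excluded middle, which is assumed below wherever a decision is made,
-- the upper part is the complement and carries no further information.

record ℝ : Set₁ where
  field
    Lower     : Pred ℚ 0ℓ
    inhabited : Satisfiable Lower
    proper    : ∃ λ p → ¬ Lower p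
    closed    : ∀ {p q} → p ℚ.< q → Lower q → Lower p
    rounded   : ∀ {p} → Lower p → ∃ λ q → p ℚ.< q × Lower q

open ℝ

infix  4 _≤_ _≈_
infixl 6 _+_

_≤_ : ℝ → ℝ → Set
x ≤ y = Lower x ⊆ Lower y

_≈_ : ℝ → ℝ → Set
x ≈ y = x ≤ y × y ≤ x

open NonStrictToStrict _≈_ _≤_ public using (_<_)

0ℝ : ℝ
0ℝ .Lower p   = p ℚ.< 0ℚ
0ℝ .inhabited = ℚ.- 1ℚ , ℚ.negative⁻¹ (ℚ.- 1ℚ)
0ℝ .proper    = 0ℚ , ℚ.<-irrefl refl
0ℝ .closed    = ℚ.<-trans
0ℝ .rounded p<0 with ℚ.<-dense p<0
... | q , p<q , q<0 = q , p<q , q<0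

member<nonmember : ∀ x {p q} → Lower x p → ¬ Lower x q → p ℚ.< q
member<nonmember x {p} {q} p∈x q∉x with ℚ.<-cmp p q
... | tri< p<q _ _  = p<q
... | tri≈ _ refl _ = contradiction p∈x q∉x
... | tri> _ _ q<p  = contradiction (closed x q<p p∈x) q∉x

_+_ : ℝ → ℝ → ℝ
(x + y) .Lower r = ∃ λ p → ∃ λ q → Lower x p × Lower y q × r ≡ p ℚ.+ q
(x + y) .inhabited =
  let p , p∈x = inhabited x
      q , q∈y = inhabited y
  in p ℚ.+ q , p , q , p∈x , q∈y , refl
(x + y) .proper =
  let a , a∉x = proper x
      b , b∉y = proper y
  in a ℚ.+ b , λ (p , q , p∈x , q∈y , a+b≡p+q) →
       ℚ.<-irrefl (sym a+b≡p+q)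
         (ℚ.+-mono-< (member<nonmember x p∈x a∉x) (member<nonmember y q∈y b∉y))
(x + y) .closed {r} r<s (p , q , p∈x , q∈y , refl) =
  p , ℚ.- p ℚ.+ r , p∈x ,
  closed y (subst (ℚ.- p ℚ.+ r ℚ.<_) (-p+[p+z]≡z q) (ℚ.+-monoʳ-< (ℚ.- p) r<s)) q∈y ,
  sym p+[-p+r]≡r
  where
  open ≡-Reasoning
  -p+[p+z]≡z : ∀ z → ℚ.- p ℚ.+ (p ℚ.+ z) ≡ z
  -p+[p+z]≡z z = begin
    ℚ.- p ℚ.+ (p ℚ.+ z) ≡⟨ ℚ.+-assoc (ℚ.- p) p z ⟨
    ℚ.- p ℚ.+ p ℚ.+ z   ≡⟨ cong (ℚ._+ z) (ℚ.+-inverseˡ p) ⟩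
    0ℚ ℚ.+ z            ≡⟨ ℚ.+-identityˡ z ⟩
    z                   ∎
  p+[-p+r]≡r : p ℚ.+ (ℚ.- p ℚ.+ r) ≡ r
  p+[-p+r]≡r = begin
    p ℚ.+ (ℚ.- p ℚ.+ r) ≡⟨ ℚ.+-assoc p (ℚ.- p) r ⟨
    p ℚ.+ ℚ.- p ℚ.+ r   ≡⟨ cong (ℚ._+ r) (ℚ.+-inverseʳ p) ⟩
    0ℚ ℚ.+ r            ≡⟨ ℚ.+-identityˡ r ⟩
    r                   ∎
(x + y) .rounded (p , q , p∈x , q∈y , refl) =
  let p′ , p<p′ , p′∈x = rounded x p∈x
  in p′ ℚ.+ q , ℚ.+-monoˡ-< q p<p′ , p′ , q , p′∈x , q∈y , refl

≈-isEquivalence : IsEquivalence _≈_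
≈-isEquivalence = record
  { refl  = id , id
  ; sym   = λ (x≤y , y≤x) → y≤x , x≤y
  ; trans = λ (x≤y , y≤x) (y≤z , z≤y) → y≤z ∘ x≤y , y≤x ∘ z≤y
  }

≤-isPartialOrder : IsPartialOrder _≈_ _≤_
≤-isPartialOrder = record
  { isPreorder = record
    { isEquivalence = ≈-isEquivalence
    ; reflexive     = proj₁
    ; trans         = λ x≤y y≤z → y≤z ∘ x≤y
    }
  ; antisym = _,_
  }

module _ (em : ExcludedMiddle 0ℓ) where

  ≤-total : Total _≤_
  ≤-total x y with em {∃ λ p → Lower x p × ¬ Lower y p}
  ... | yes (p , p∈x , p∉y) = inj₂ λ q∈y → closed x (member<nonmember y q∈y p∉y) p∈x
  ... | no  x⊈y             = inj₁ λ {p} p∈x → decide p p∈x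
    where
    decide : ∀ p → Lower x p → Lower y p
    decide p p∈x with em {Lower y p}
    ... | yes p∈y = p∈y
    ... | no  p∉y = contradiction (p , p∈x , p∉y) x⊈y

  ≤-totalOrder : TotalOrder _ _ _
  ≤-totalOrder = record
    { isTotalOrder = record { isPartialOrder = ≤-isPartialOrder ; total = ≤-total } }

  minimum : List ℝ → Maybe ℝ
  minimum []       = nothing
  minimum (x ∷ xs) = just (Extrema.min ≤-totalOrder x xs)

record TranslationInvariantMetric {c ℓ} (X : AbelianGroup c ℓ) : Set (lsuc 0ℓ ⊔ c ⊔ ℓ) where
  private module X = AbelianGroup X
  field
    d                    : X.Carrier → X.Carrier → ℝ
    isMetric             : IsGeneralMetric X._≈_ _≈_ _≤_ 0ℝ _+_ d
    translationInvariant : TranslationInvariant _≈_ X._∙_ d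

  open IsGeneralMetric isMetric public using (≈⇒0; 0⇒≈)

IsLeast : ∀ {p} → Pred ℕ p → Pred ℕ p
IsLeast P m = P m × (∀ {k} → P k → m ℕ.≤ k)

module _ {c ℓ} {X : AbelianGroup c ℓ} (metric : TranslationInvariantMetric X)
         (α : AbelianGroup.Carrier X) where

  open AbelianGroup X using (Carrier; ε; rawMonoid) renaming (_≈_ to _≈ₓ_)
  open RawMonoid rawMonoid using () renaming (_×_ to _·_)
  open TranslationInvariantMetric metric

  ρ : ℕ → ℝ
  ρ q = d (q · α) ε

  -- BestReturn n q: the n-th strict best-return denominator exists and equals q.
  -- Indices start at 1; a sequence terminating before n has no q with BestReturn n q.
  data BestReturn : ℕ → ℕ → Set where
    first : BestReturn 1 1
    next  : ∀ {n q q′} → BestReturn n q →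
            IsLeast (λ r → q ℕ.< r × ρ r < ρ q) q′ → BestReturn (suc n) q′

  module _ (em : ExcludedMiddle 0ℓ) where

    -- A metric reduces equality of points to equality of reals, so excluded
    -- middle at level zero suffices for X in any universe.
    _≟ₓ_ : Decidable _≈ₓ_
    x ≟ₓ y = map′ 0⇒≈ ≈⇒0 (em {d x y ≈ 0ℝ})

    _≟ᵣ_ : Decidable _≈_
    x ≟ᵣ y = em

    orbit : ℕ → List Carrier
    orbit N = deduplicate _≟ₓ_ (map (_· α) (upTo N))

    -- The value is nothing only if the orbit has no point other than x.
    δ : ℕ → Carrier → Maybe ℝ
    δ N x = minimum em (map (d x) (filter (λ y → ¬? (y ≟ₓ x)) (orbit N)))

    -- A singleton orbit contributes no distance, so then g N ≡ 0.
    g : ℕ → ℕ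
    g N = length (deduplicate _≟ᵣ_ (mapMaybe (δ N) (orbit N)))

{-# OPTIONS --safe #-}
-- Put N′ = N − 1.  If T α = 0 for some 1 ≤ T ≤ N′, the orbit is a finite cyclic
-- group, on which δ_N is constant.  Otherwise δ_N (i α) is the minimum of ρ over
-- [1, m] with m = max (i, N′ − i), that is, the value of ρ at the last best return
-- up to m.  As h = ⌈N′/2⌉ ≤ m ≤ N′, the distinct values number at most one more
-- than the best returns in (h, N′], and M + 1 consecutive best returns cannot fit
-- there, because the last would be at least 2 (h + 1) > N′.
module Submission where

open import Defs
open import Algebra.Bundles using (AbelianGroup)
open import Axiom.ExcludedMiddle using (ExcludedMiddle)
open import Data.Empty using (⊥-elim)
open import Data.Fin.Base as Fin using (Fin; toℕ; fromℕ<)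
open import Data.Fin.Properties using (pigeonhole; toℕ-fromℕ<)
open import Data.List.Base using ([]; _∷_; deduplicate; filter; length; lookup; map; upTo)
open import Data.List.Membership.Propositional using (_∈_; find)
open import Data.List.Membership.Propositional.Properties
  using (∈-deduplicate⁻; ∈-filter⁺; ∈-filter⁻; ∈-lookup; ∈-map⁺; ∈-map⁻; ∈-upTo⁺; ∈-upTo⁻)
open import Data.List.Relation.Unary.All as All using (All; _∷_)
import Data.List.Relation.Unary.All.Properties as All
import Data.List.Relation.Unary.Any as Any
import Data.List.Relation.Unary.Any.Properties as Any
open import Data.List.Relation.Unary.AllPairs using (AllPairs; _∷_)
open import Data.List.Relation.Unary.Unique.DecSetoid.Properties using (deduplicate-!)
open import Data.Maybe.Relation.Unary.All as Maybe using (just; nothing)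
open import Data.Nat.Base using (ℕ; zero; suc; z≤n; s≤s; ⌈_/2⌉; ⌊_/2⌋; ∣_-_∣; _∸_; _⊔_)
  renaming (_+_ to _+ℕ_; _*_ to _*ℕ_; _≤_ to _≤ℕ_; _<_ to _<ℕ_)
import Data.Nat.Properties as ℕ
open import Data.Product.Base using (_×_; ∃; ∃₂; _,_; proj₁; proj₂)
open import Data.Sum.Base using (inj₁; inj₂)
open import Function.Base using (_∘_)
open import Function.Metric.Structures using (IsGeneralMetric)
open import Level using (0ℓ)
open import Relation.Binary.Bundles using (DecSetoid; Setoid)
open import Relation.Binary.Definitions using (Decidable)
open import Relation.Binary.PropositionalEquality using (_≡_; refl; sym; cong; subst; module ≡-Reasoning)
open import Relation.Nullary using (¬_; yes; no)
open import Relation.Nullary.Decidable using (¬?)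
open import Relation.Unary using (Pred)
import Algebra.Definitions.RawMonoid as RawMonoid
import Data.List.Extrema as Extrema
import Relation.Binary.Reasoning.Setoid as SetoidReasoning

-- Counting distinct values, and minima of lists of reals.

ℝ-setoid : Setoid _ _
ℝ-setoid = record { isEquivalence = ≈-isEquivalence }

module ≈ = Setoid ℝ-setoid

AllPairs-lookup : ∀ {a r} {A : Set a} {R : A → A → Set r} {xs} → AllPairs R xs →
  ∀ {i j} → i Fin.< j → R (lookup xs i) (lookup xs j)
AllPairs-lookup {xs = _ ∷ xs} (Rx ∷ _) {Fin.zero} {Fin.suc j} _ = All.lookup Rx (∈-lookup {xs = xs} j)
AllPairs-lookup (_ ∷ Rxs) {Fin.suc i} {Fin.suc j} (s≤s i<j) = AllPairs-lookup Rxs i<j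

module _ {a ℓ} (S : DecSetoid a ℓ) where
  open DecSetoid S using (Carrier; _≟_) renaming (_≈_ to _≈ₛ_)

  -- Pigeonhole: with more than `n` entries left, two would share a code and hence be equal, against
  -- uniqueness. `Code` is a relation so that a code can carry the witness that justifies it.
  length-deduplicate-≤ : ∀ {n c} (Code : Carrier → Fin n → Set c) →
    (∀ {x y k} → Code x k → Code y k → x ≈ₛ y) →
    ∀ xs → All (∃ ∘ Code) xs → length (deduplicate _≟_ xs) ≤ℕ n
  length-deduplicate-≤ Code same xs codes = ℕ.≮⇒≥ λ n<len →
    let i , j , i<j , kᵢ≡kⱼ = pigeonhole n<len (proj₁ ∘ code)
    in AllPairs-lookup (deduplicate-! S xs) i<j
         (same (subst (Code _) kᵢ≡kⱼ (proj₂ (code i))) (proj₂ (code j)))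
    where
    us = deduplicate _≟_ xs
    code : ∀ i → ∃ (Code (lookup us i))
    code i = All.lookup (All.deduplicate⁺ _≟_ codes) (∈-lookup {xs = us} i)

≮⇒≥ : ExcludedMiddle 0ℓ → ∀ {x y} → ¬ x < y → y ≤ x
≮⇒≥ em {x} {y} x≮y with ≤-total em x y
... | inj₂ y≤x = y≤x
... | inj₁ x≤y with em {x ≈ y}
...   | yes x≈y = proj₂ x≈y
...   | no  x≉y = ⊥-elim (x≮y ((λ {p} → x≤y {p}) , x≉y))

-- The minimum is itself an entry, so it inherits any property that all entries have.
minimum-all : ∀ (em : ExcludedMiddle 0ℓ) {p} {P : Pred ℝ p} {xs} → All P xs →
  Maybe.All (λ v → P v × All (v ≤_) xs) (minimum em xs)
minimum-all em {xs = []}     _          = nothing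
minimum-all em {P = P} {xs = x ∷ xs} (px ∷ pxs) = just
  ( argmin-all (λ v → v) {P = P} px pxs
  , min≤⊤ x xs ∷ min≤xs x xs )
  where open Extrema (≤-totalOrder em)

-- Index differences inside an interval [0, n].

n≤2⌈n/2⌉ : ∀ n → n ≤ℕ 2 *ℕ ⌈ n /2⌉
n≤2⌈n/2⌉ n = begin
  n                        ≡⟨ ℕ.⌊n/2⌋+⌈n/2⌉≡n n ⟨
  ⌊ n /2⌋ +ℕ ⌈ n /2⌉       ≤⟨ ℕ.+-monoˡ-≤ ⌈ n /2⌉ (ℕ.⌊n/2⌋≤⌈n/2⌉ n) ⟩
  ⌈ n /2⌉ +ℕ ⌈ n /2⌉       ≡⟨ cong (⌈ n /2⌉ +ℕ_) (ℕ.+-identityʳ ⌈ n /2⌉) ⟨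
  2 *ℕ ⌈ n /2⌉             ∎
  where open ℕ.≤-Reasoning

-- The two sides of `i` have total length at least `n`, so twice the longer one covers `n`.
⌈n/2⌉≤i⊔[n∸i] : ∀ n i → ⌈ n /2⌉ ≤ℕ i ⊔ (n ∸ i)
⌈n/2⌉≤i⊔[n∸i] n i = begin
  ⌈ n /2⌉        ≤⟨ ℕ.⌈n/2⌉-mono n≤m+m ⟩
  ⌈ m +ℕ m /2⌉   ≡⟨ ℕ.n≡⌈n+n/2⌉ m ⟨
  m              ∎
  where
  open ℕ.≤-Reasoning
  m = i ⊔ (n ∸ i)
  n≤m+m : n ≤ℕ m +ℕ m
  n≤m+m = ℕ.≤-trans (ℕ.m≤n+m∸n n i)
    (ℕ.+-mono-≤ (ℕ.m≤m⊔n i (n ∸ i)) (ℕ.m≤n⊔m i (n ∸ i)))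

-- The longer side of `i` in [0, n] has room for a step of length `q`: left to `i ∸ q` or right to
-- `i + q`.
at-distance : ∀ {n i q} → i ≤ℕ n → q ≤ℕ i ⊔ (n ∸ i) → ∃ λ j → j ≤ℕ n × ∣ i - j ∣ ≡ q
at-distance {n} {i} {q} i≤n q≤m with ℕ.⊔-sel i (n ∸ i)
... | inj₁ m≡i = i ∸ q , ℕ.≤-trans (ℕ.m∸n≤m i q) i≤n , (begin
    ∣ i - i ∸ q ∣   ≡⟨ ℕ.m≤n⇒∣n-m∣≡n∸m (ℕ.m∸n≤m i q) ⟩
    i ∸ (i ∸ q)     ≡⟨ ℕ.m∸[m∸n]≡n (subst (q ≤ℕ_) m≡i q≤m) ⟩
    q               ∎)
  where open ≡-Reasoning
... | inj₂ m≡n∸i = i +ℕ q , (begin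
    i +ℕ q         ≤⟨ ℕ.+-monoʳ-≤ i (subst (q ≤ℕ_) m≡n∸i q≤m) ⟩
    i +ℕ (n ∸ i)   ≡⟨ ℕ.m+[n∸m]≡n i≤n ⟩
    n              ∎) , ℕ.∣m-m+n∣≡n i q
  where open ℕ.≤-Reasoning

-- For `i ≤ n`, this and `at-distance` identify the offsets from `i` within [0, n] as exactly 0 to
-- `i ⊔ (n ∸ i)`.
∣i-j∣≤i⊔[n∸i] : ∀ {n i j} → j ≤ℕ n → ∣ i - j ∣ ≤ℕ i ⊔ (n ∸ i)
∣i-j∣≤i⊔[n∸i] {n} {i} {j} j≤n with ℕ.≤-total i j
... | inj₁ i≤j = begin
    ∣ i - j ∣     ≡⟨ ℕ.m≤n⇒∣m-n∣≡n∸m i≤j ⟩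
    j ∸ i         ≤⟨ ℕ.∸-monoˡ-≤ i j≤n ⟩
    n ∸ i         ≤⟨ ℕ.m≤n⊔m i (n ∸ i) ⟩
    i ⊔ (n ∸ i)   ∎
  where open ℕ.≤-Reasoning
... | inj₂ j≤i = begin
    ∣ i - j ∣     ≡⟨ ℕ.m≤n⇒∣n-m∣≡n∸m j≤i ⟩
    i ∸ j         ≤⟨ ℕ.m∸n≤m i j ⟩
    i             ≤⟨ ℕ.m≤m⊔n i (n ∸ i) ⟩
    i ⊔ (n ∸ i)   ∎
  where open ℕ.≤-Reasoning

-- Distances between multiples of `α`.

module _ {c ℓ} {X : AbelianGroup c ℓ} (metric : TranslationInvariantMetric X)
         (α : AbelianGroup.Carrier X) where

  private
    module X = AbelianGroup X
    module D = IsGeneralMetric (TranslationInvariantMetric.isMetric metric)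
  open TranslationInvariantMetric metric
  open RawMonoid X.rawMonoid using () renaming (_×_ to _·_)

  private
    R : ℕ → ℝ
    R = ρ metric α

    Best : ℕ → ℕ → Set
    Best = BestReturn metric α

  -- Common summands `α` are cancelled one at a time. Multiples grow on the left while invariance
  -- translates on the right, whence the use of commutativity.
  d≈ρ : ∀ i j → d (i · α) (j · α) ≈ R ∣ i - j ∣
  d≈ρ zero    j       = D.sym X.ε (j · α)
  d≈ρ (suc i) zero    = ≈.refl {R (suc i)}
  d≈ρ (suc i) (suc j) = begin
    d (α X.∙ i · α) (α X.∙ j · α)   ≈⟨ D.cong (X.comm α (i · α)) (X.comm α (j · α)) ⟩
    d (i · α X.∙ α) (j · α X.∙ α)   ≈⟨ translationInvariant {i · α} {j · α} {α} ⟩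
    d (i · α) (j · α)               ≈⟨ d≈ρ i j ⟩
    R ∣ i - j ∣                     ∎
    where open SetoidReasoning ℝ-setoid

  ρ≈0⇒≈ : ∀ i j → R ∣ i - j ∣ ≈ 0ℝ → i · α X.≈ j · α
  ρ≈0⇒≈ i j ρ≈0 = 0⇒≈ (≈.trans {d (i · α) (j · α)} {R ∣ i - j ∣} {0ℝ} (d≈ρ i j) ρ≈0)

  ≈⇒ρ≈0 : ∀ i j → i · α X.≈ j · α → R ∣ i - j ∣ ≈ 0ℝ
  ≈⇒ρ≈0 i j i≈j = begin
    R ∣ i - j ∣         ≈⟨ d≈ρ i j ⟨
    d (i · α) (j · α)   ≈⟨ ≈⇒0 i≈j ⟩
    0ℝ                  ∎
    where open SetoidReasoning ℝ-setoid

  ρ0≈0 : R 0 ≈ 0ℝ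
  ρ0≈0 = ≈⇒0 X.refl

  -- The sequence of best returns.

  BestReturn-≥1 : ∀ {n q} → Best n q → 1 ≤ℕ q
  BestReturn-≥1 first                    = s≤s z≤n
  BestReturn-≥1 (next _ ((q<q′ , _) , _)) = ℕ.m<n⇒0<n q<q′

  BestReturn-unique : ∀ {n q q′} → Best n q → Best n q′ → q ≡ q′
  BestReturn-unique first first = refl
  BestReturn-unique first (next () _)
  BestReturn-unique (next () _) first
  BestReturn-unique (next b (P , least)) (next b′ (P′ , least′))
    with refl ← BestReturn-unique b b′ = ℕ.≤-antisym (least P′) (least′ P)

  BestReturn-step : ∀ {n q q′} → Best n q → Best (suc n) q′ → q <ℕ q′ × R q′ < R q
  BestReturn-step () first
  BestReturn-step b (next b′ (q<q′ , _)) with refl ← BestReturn-unique b b′ = q<q′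

  -- Each return is built on its predecessor, so descending the derivation reaches every smaller
  -- index. This supplies the intermediate returns whose existence the growth hypotheses presuppose.
  BestReturn-earlier : ∀ {m n q′} → 1 ≤ℕ m → m ≤ℕ n → Best n q′ → ∃ λ q → Best m q × q ≤ℕ q′
  BestReturn-earlier 1≤m m≤1 first with refl ← ℕ.≤-antisym m≤1 1≤m = 1 , first , ℕ.≤-refl
  BestReturn-earlier 1≤m m≤1+n (next b l@((q<q′ , _) , _)) with ℕ.m≤n⇒m<n∨m≡n m≤1+n
  ... | inj₂ refl = _ , next b l , ℕ.≤-refl
  ... | inj₁ (s≤s m≤n) =
    let q , b′ , q≤ = BestReturn-earlier 1≤m m≤n b
    in q , b′ , ℕ.≤-trans q≤ (ℕ.<⇒≤ q<q′)

  -- Being the last best return up to `m` is encoded as minimality of `ρ q` on [1, m]: a later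
  -- return in that range would have a strictly smaller `ρ`.
  LastReturn : ℕ → ℕ → ℕ → Set
  LastReturn m k q = Best k q × q ≤ℕ m × (∀ {j} → 1 ≤ℕ j → j ≤ℕ m → R q ≤ R j)

  -- Induction on `m`: the new index either undercuts the current minimum, and is then the next best
  -- return, or leaves the minimum unchanged.
  lastReturn : ExcludedMiddle 0ℓ → ∀ m → 1 ≤ℕ m → ∃₂ (LastReturn m)
  lastReturn em 1 _ =
    1 , 1 , first , ℕ.≤-refl , λ { (s≤s z≤n) (s≤s z≤n) p → p }
  lastReturn em (suc m@(suc _)) _ with lastReturn em m (s≤s z≤n)
  ... | k , q , b , q≤m , least with em {R (suc m) < R q}
  ...   | yes ρ< = suc k , suc m , next b ((s≤s q≤m , ρ<) , isLeast) , ℕ.≤-refl , least′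
    where
    isLeast : ∀ {r} → q <ℕ r × R r < R q → suc m ≤ℕ r
    isLeast {r} (q<r , ρr≤ρq , ρr≉ρq) =
      ℕ.≰⇒> λ r≤m → ρr≉ρq (ρr≤ρq , least (ℕ.m<n⇒0<n q<r) r≤m)
    least′ : ∀ {j} → 1 ≤ℕ j → j ≤ℕ suc m → R (suc m) ≤ R j
    least′ 1≤j j≤1+m with ℕ.m≤n⇒m<n∨m≡n j≤1+m
    ... | inj₁ (s≤s j≤m) = λ p → least 1≤j j≤m (proj₁ ρ< p)
    ... | inj₂ refl      = λ p → p
  ...   | no ρ≮ = k , q , b , ℕ.m≤n⇒m≤1+n q≤m , least′
    where
    ρq≤ρ : R q ≤ R (suc m)
    ρq≤ρ = ≮⇒≥ em {R (suc m)} {R q} ρ≮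
    least′ : ∀ {j} → 1 ≤ℕ j → j ≤ℕ suc m → R q ≤ R j
    least′ 1≤j j≤1+m with ℕ.m≤n⇒m<n∨m≡n j≤1+m
    ... | inj₁ (s≤s j≤m) = least 1≤j j≤m
    ... | inj₂ refl      = ρq≤ρ

  LastReturn-next : ∀ {m k q q′} → LastReturn m k q → Best (suc k) q′ → m <ℕ q′
  LastReturn-next (b , _ , least) b′ =
    let _ , ρ≤ , ρ≉ = BestReturn-step b b′
    in ℕ.≰⇒> λ q′≤m → ρ≉ (ρ≤ , least (BestReturn-≥1 b′) q′≤m)

  -- If `k′ < k`, the return of index `k′ + 1` would exist and exceed `m′`, yet be at most
  -- `q ≤ m ≤ m′`.
  LastReturn-mono : ∀ {m m′ k k′ q q′} → m ≤ℕ m′ →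
    LastReturn m k q → LastReturn m′ k′ q′ → k ≤ℕ k′
  LastReturn-mono m≤m′ (b , q≤m , _) l′ = ℕ.≮⇒≥ λ k′<k →
    let _ , b′ , q″≤q = BestReturn-earlier (s≤s z≤n) k′<k b
    in ℕ.<⇒≱ (LastReturn-next l′ b′) (ℕ.≤-trans q″≤q (ℕ.≤-trans q≤m m≤m′))

  -- Growth hypotheses and the number of returns in (h, 2h].

  Doubling : ℕ → Set
  Doubling M = ∀ n qₙ qₙ₊ₘ → 1 ≤ℕ n → Best n qₙ → Best (n +ℕ M) qₙ₊ₘ → 2 *ℕ qₙ ≤ℕ qₙ₊ₘ

  -- Strict increase gives `2 qₙ ≤ qₙ + qₙ₊₁`; since `M ≥ 1`, the term `qₙ₊₁` exists whenever `qₙ₊ₘ`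
  -- does.
  sum-growth⇒Doubling : ∀ {M} → 1 ≤ℕ M →
    (∀ n qₙ qₙ₊₁ qₙ₊ₘ → 1 ≤ℕ n → Best n qₙ → Best (suc n) qₙ₊₁ → Best (n +ℕ M) qₙ₊ₘ →
      qₙ +ℕ qₙ₊₁ ≤ℕ qₙ₊ₘ) →
    Doubling M
  sum-growth⇒Doubling {M} 1≤M growth n q q″ 1≤n b b″ =
    let q′ , b′ , _ = BestReturn-earlier (s≤s z≤n) 1+n≤n+M b″
    in begin
      2 *ℕ q    ≡⟨ cong (q +ℕ_) (ℕ.+-identityʳ q) ⟩
      q +ℕ q    ≤⟨ ℕ.+-monoʳ-≤ q (ℕ.<⇒≤ (proj₁ (BestReturn-step b b′))) ⟩
      q +ℕ q′   ≤⟨ growth n q q′ q″ 1≤n b b′ b″ ⟩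
      q″        ∎
    where
    open ℕ.≤-Reasoning
    1+n≤n+M : suc n ≤ℕ n +ℕ M
    1+n≤n+M = subst (_≤ℕ n +ℕ M) (ℕ.+-comm n 1) (ℕ.+-monoʳ-≤ n 1≤M)

  -- If `k > k₀ + M`, the returns of indices `k₀ + 1` and `k₀ + 1 + M` exist. The former exceeds
  -- `h`, so the latter exceeds `2 h ≥ m`, although it is at most `q ≤ m`.
  Doubling⇒index-≤ : ∀ {M h m k₀ q₀ k q} → Doubling M → m ≤ℕ 2 *ℕ h →
    LastReturn h k₀ q₀ → LastReturn m k q → k ≤ℕ k₀ +ℕ M
  Doubling⇒index-≤ {M} {h} {m} {k₀} {q = q} doubling m≤2h l₀ (b , q≤m , _) = ℕ.≮⇒≥ λ k₀+M<k →
    let q₂ , b₂ , q₂≤q = BestReturn-earlier (s≤s z≤n) k₀+M<k b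
        q₁ , b₁ , _    = BestReturn-earlier (s≤s z≤n) (ℕ.m≤m+n (suc k₀) M) b₂
    in ℕ.<-irrefl refl (begin-strict
      m           ≤⟨ m≤2h ⟩
      2 *ℕ h      <⟨ ℕ.*-monoʳ-< 2 (LastReturn-next l₀ b₁) ⟩
      2 *ℕ q₁     ≤⟨ doubling (suc k₀) q₁ q₂ (s≤s z≤n) b₁ b₂ ⟩
      q₂          ≤⟨ q₂≤q ⟩
      q           ≤⟨ q≤m ⟩
      m           ∎)
    where open ℕ.≤-Reasoning

  -- Nearest-neighbour distances in terms of indices; the aperiodic case.

  record IsNearest (N i : ℕ) (v : ℝ) : Set where
    constructor nearest
    field
      {index}     : ℕ
      index<N     : index <ℕ N
      -- Different indices may name the same point, so distinctness is a nonzero distance.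
      ρ≉0         : ¬ R ∣ i - index ∣ ≈ 0ℝ
      value       : v ≈ R ∣ i - index ∣
      lower-bound : ∀ {j} → j <ℕ N → ¬ R ∣ i - j ∣ ≈ 0ℝ → v ≤ R ∣ i - j ∣

  -- Offsets from `i` run over [0, m] with `m = i ⊔ (N′ ∸ i)`. With no zero return up to `N′`, every
  -- positive offset competes, so `v` is the minimum of `ρ` on [1, m].
  IsNearest-lastReturn : ∀ {N′ i v k q} →
    (∀ {t} → 1 ≤ℕ t → t ≤ℕ N′ → ¬ R t ≈ 0ℝ) →
    i ≤ℕ N′ → IsNearest (suc N′) i v → LastReturn (i ⊔ (N′ ∸ i)) k q → v ≈ R q
  IsNearest-lastReturn {N′} {i} {v} {k} {q} aperiodic i≤N′
                       (nearest {j} (s≤s j≤N′) ρ≉0 v≈ρ v-least) (b , q≤m , q-least) =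
    v≤ρq , λ p → proj₂ v≈ρ (q-least 1≤∣i-j∣ (∣i-j∣≤i⊔[n∸i] {i = i} j≤N′) p)
    where
    1≤∣i-j∣ : 1 ≤ℕ ∣ i - j ∣
    1≤∣i-j∣ = ℕ.n≢0⇒n>0 λ ≡0 → ρ≉0 (subst (λ t → R t ≈ 0ℝ) (sym ≡0) ρ0≈0)
    m≤N′ : i ⊔ (N′ ∸ i) ≤ℕ N′
    m≤N′ = ℕ.⊔-lub i≤N′ (ℕ.m∸n≤m N′ i)
    v≤ρq : v ≤ R q
    v≤ρq with at-distance i≤N′ q≤m
    ... | j′ , j′≤N′ , refl =
      v-least (s≤s j′≤N′) (aperiodic (BestReturn-≥1 b) (ℕ.≤-trans q≤m m≤N′))

  -- The periodic case.

  multiple≈residue : ∀ {T} → 1 ≤ℕ T → T · α X.≈ X.ε → ∀ n → ∃ λ r → r <ℕ T × n · α X.≈ r · α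
  multiple≈residue 1≤T Tα≈0 zero = 0 , 1≤T , X.refl
  multiple≈residue {T} 1≤T Tα≈0 (suc n) with multiple≈residue 1≤T Tα≈0 n
  ... | r , r<T , nα≈rα with ℕ.m≤n⇒m<n∨m≡n r<T
  ...   | inj₁ 1+r<T = suc r , 1+r<T , X.∙-congˡ nα≈rα
  -- When `r + 1` reaches `T`, the residue wraps round to 0.
  ...   | inj₂ refl  = 0 , 1≤T , X.trans (X.∙-congˡ nα≈rα) Tα≈0

  -- The index `i + t` may lie beyond `N`, but its residue modulo `T` does not, so the point at
  -- offset `t` from `i` always belongs to the orbit.
  IsNearest-≤ : ∀ {N T} → 1 ≤ℕ T → T <ℕ N → R T ≈ 0ℝ →
    ∀ {i v} → IsNearest N i v → ∀ t → ¬ R t ≈ 0ℝ → v ≤ R t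
  IsNearest-≤ 1≤T T<N ρT≈0 {i} near t ρt≉0
    with multiple≈residue 1≤T (0⇒≈ ρT≈0) (i +ℕ t)
  ... | r , r<T , i+t≈r = λ p → proj₂ ρt≈ρ
      (IsNearest.lower-bound near (ℕ.<-trans r<T T<N)
        (λ ρ≈0 → ρt≉0 (≈.trans {R t} {R ∣ i - r ∣} {0ℝ} ρt≈ρ ρ≈0)) p)
    where
    open SetoidReasoning ℝ-setoid
    ρt≈ρ : R t ≈ R ∣ i - r ∣
    ρt≈ρ = begin
      R t                        ≡⟨ cong R (ℕ.∣m-m+n∣≡n i t) ⟨
      R ∣ i - i +ℕ t ∣           ≈⟨ d≈ρ i (i +ℕ t) ⟨
      d (i · α) ((i +ℕ t) · α)   ≈⟨ D.cong X.refl i+t≈r ⟩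
      d (i · α) (r · α)          ≈⟨ d≈ρ i r ⟩
      R ∣ i - r ∣                ∎

  -- Each value is itself some nonzero `ρ t`, hence bounded below by the other.
  IsNearest-periodic : ∀ {N T} → 1 ≤ℕ T → T <ℕ N → R T ≈ 0ℝ →
    ∀ {i j v w} → IsNearest N i v → IsNearest N j w → v ≈ w
  IsNearest-periodic 1≤T T<N ρT≈0 {i} {j} near near′ =
    (λ p → proj₂ (value near′)
      (IsNearest-≤ 1≤T T<N ρT≈0 near ∣ j - index near′ ∣ (ρ≉0 near′) p)) ,
    (λ p → proj₂ (value near)
      (IsNearest-≤ 1≤T T<N ρT≈0 near′ ∣ i - index near ∣ (ρ≉0 near) p))
    where open IsNearest

  -- From the orbit list to the bound on `g`.

  module _ (em : ExcludedMiddle 0ℓ) where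

    private
      _≟_ : Decidable X._≈_
      _≟_ = _≟ₓ_ metric α em

    ∈-orbit⁻ : ∀ {N x} → x ∈ orbit metric α em N → ∃ λ i → i <ℕ N × x ≡ i · α
    ∈-orbit⁻ {N} x∈ with ∈-map⁻ (_· α) (∈-deduplicate⁻ _≟_ (map (_· α) (upTo N)) x∈)
    ... | i , i∈ , x≡ = i , ∈-upTo⁻ i∈ , x≡

    -- Deduplication keeps only one representative of each point, so `j · α` itself may be absent
    -- from the list.
    ∈-orbit⁺ : ∀ {N j} → j <ℕ N → ∃ λ y → y ∈ orbit metric α em N × y X.≈ j · α
    ∈-orbit⁺ {N} {j} j<N = find (Any.deduplicate⁺ _≟_ (λ y≈z z≈ → X.trans y≈z z≈)
      (Any.map (λ { refl → X.refl }) (∈-map⁺ (_· α) (∈-upTo⁺ j<N))))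

    -- `Maybe.All` is vacuous at `nothing`, so a point without neighbours needs no separate case.
    δ-nearest : ∀ N i → Maybe.All (IsNearest N i) (δ metric α em N (i · α))
    δ-nearest N i = Maybe.map isNearest (minimum-all em (All.map⁺ (All.tabulate distance)))
      where
      others = filter (λ y → ¬? (y ≟ (i · α))) (orbit metric α em N)
      Distance : ℝ → Set
      Distance v = ∃ λ j → j <ℕ N × ¬ R ∣ i - j ∣ ≈ 0ℝ × v ≈ R ∣ i - j ∣
      distance : ∀ {y} → y ∈ others → Distance (d (i · α) y)
      distance y∈ with ∈-filter⁻ (λ y → ¬? (y ≟ (i · α))) {xs = orbit metric α em N} y∈
      ... | y∈orbit , y≉x with ∈-orbit⁻ y∈orbit
      ...   | j , j<N , refl = j , j<N , (λ ρ≈0 → y≉x (X.sym (ρ≈0⇒≈ i j ρ≈0))) , d≈ρ i j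
      isNearest : ∀ {v} → Distance v × All (v ≤_) (map (d (i · α)) others) → IsNearest N i v
      isNearest {v} ((_ , j<N , ρ≉0 , v≈ρ) , v≤) = nearest j<N ρ≉0 v≈ρ lower-bound
        where
        lower-bound : ∀ {j} → j <ℕ N → ¬ R ∣ i - j ∣ ≈ 0ℝ → v ≤ R ∣ i - j ∣
        lower-bound {j} j<N ρ≉0 with ∈-orbit⁺ j<N
        ... | y , y∈orbit , y≈jα = λ p → proj₁ (d≈ρ i j) (proj₁ (D.cong X.refl y≈jα)
            (All.lookup v≤ (∈-map⁺ (d (i · α)) (∈-filter⁺ _ y∈orbit y≉x)) p))
          where
          y≉x : ¬ y X.≈ i · α
          y≉x y≈x = ρ≉0 (≈⇒ρ≈0 i j (X.trans (X.sym y≈x) y≈jα))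

    ℝ-decSetoid : DecSetoid _ _
    ℝ-decSetoid = record
      { isDecEquivalence = record { isEquivalence = ≈-isEquivalence ; _≟_ = _≟ᵣ_ metric α em } }

    g-≤ : ∀ {N n c} (Code : ℝ → Fin n → Set c) →
      (∀ {v w k} → Code v k → Code w k → v ≈ w) →
      (∀ {i v} → i <ℕ N → IsNearest N i v → ∃ (Code v)) →
      g metric α em N ≤ℕ n
    g-≤ {N} Code same code =
      length-deduplicate-≤ ℝ-decSetoid Code same _ (All.mapMaybe⁺ (All.map⁺ (All.tabulate codes)))
      where
      codes : ∀ {x} → x ∈ orbit metric α em N → Maybe.All (∃ ∘ Code) (δ metric α em N x)
      codes x∈ with ∈-orbit⁻ x∈
      ... | i , i<N , refl = Maybe.map (code i<N) (δ-nearest N i)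

    Doubling⇒g-≤ : ∀ {M} → Doubling M → ∀ N → 2 ≤ℕ N → g metric α em N ≤ℕ M +ℕ 1
    Doubling⇒g-≤ {M} doubling N@(suc N′) (s≤s 1≤N′)
      with em {∃ λ T → 1 ≤ℕ T × T <ℕ N × R T ≈ 0ℝ}
    ... | yes (T , 1≤T , T<N , ρT≈0) = ℕ.≤-trans g≤1 (ℕ.m≤n+m 1 M)
      where
      g≤1 : g metric α em N ≤ℕ 1
      -- All values agree, so a single code serves.
      g≤1 = g-≤ (λ v _ → ∃ λ i → IsNearest N i v)
        (λ (_ , near) (_ , near′) → IsNearest-periodic 1≤T T<N ρT≈0 near near′)
        (λ {i} _ near → Fin.zero , i , near)
    ... | no aperiodic = g-≤ Code
        (λ {v} {w} {c} → same {v} {w} {c}) code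
      where
      h = ⌈ N′ /2⌉
      1≤h : 1 ≤ℕ h
      1≤h = ℕ.⌈n/2⌉-mono 1≤N′
      last₀ = lastReturn em h 1≤h
      k₀ = proj₁ last₀
      l₀ = proj₂ (proj₂ last₀)
      -- A value is coded by how far the index of its best return lies beyond `k₀`; the possible
      -- offsets 0 to `M` account for the bound `M + 1`.
      Code : ℝ → Fin (M +ℕ 1) → Set
      Code v c = ∃ λ q → Best (k₀ +ℕ toℕ c) q × v ≈ R q
      same : ∀ {v w c} → Code v c → Code w c → v ≈ w
      same {v} {w} (q , b , v≈) (q′ , b′ , w≈) = begin
        v      ≈⟨ v≈ ⟩
        R q    ≡⟨ cong R (BestReturn-unique b b′) ⟩
        R q′   ≈⟨ w≈ ⟨
        w      ∎
        where open SetoidReasoning ℝ-setoid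
      code : ∀ {i v} → i <ℕ N → IsNearest N i v → ∃ (Code v)
      code {i} {v} (s≤s i≤N′) near =
        fromℕ< c<M+1 , q , subst (λ n → Best n q) k≡ (proj₁ l) ,
        IsNearest-lastReturn (λ 1≤t t≤N′ ρ≈0 → aperiodic (_ , 1≤t , s≤s t≤N′ , ρ≈0)) i≤N′ near l
        where
        m = i ⊔ (N′ ∸ i)
        h≤m : h ≤ℕ m
        h≤m = ⌈n/2⌉≤i⊔[n∸i] N′ i
        m≤2h : m ≤ℕ 2 *ℕ h
        m≤2h = ℕ.≤-trans (ℕ.⊔-lub i≤N′ (ℕ.m∸n≤m N′ i)) (n≤2⌈n/2⌉ N′)
        lastₘ = lastReturn em m (ℕ.≤-trans 1≤h h≤m)
        k = proj₁ lastₘ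
        q = proj₁ (proj₂ lastₘ)
        l = proj₂ (proj₂ lastₘ)
        c<M+1 : k ∸ k₀ <ℕ M +ℕ 1
        c<M+1 = subst (k ∸ k₀ <ℕ_) (ℕ.+-comm 1 M)
          (s≤s (ℕ.m≤n+o⇒m∸n≤o k k₀ (Doubling⇒index-≤ doubling m≤2h l₀ l)))
        -- The truncated subtraction is exact because `h ≤ m` forces `k₀ ≤ k`.
        k≡ : k ≡ k₀ +ℕ toℕ (fromℕ< c<M+1)
        k≡ = begin
          k                             ≡⟨ ℕ.m+[n∸m]≡n (LastReturn-mono h≤m l₀ l) ⟨
          k₀ +ℕ (k ∸ k₀)                ≡⟨ cong (k₀ +ℕ_) (toℕ-fromℕ< c<M+1) ⟨
          k₀ +ℕ toℕ (fromℕ< c<M+1)      ∎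
          where open ≡-Reasoning

theorem2 : ∀ {c ℓ} (em : ExcludedMiddle 0ℓ) (X : AbelianGroup c ℓ)
    (metric : TranslationInvariantMetric X) (α : AbelianGroup.Carrier X) (M : ℕ) → 1 ≤ℕ M →
    ((∀ n qₙ qₙ₊ₘ → 1 ≤ℕ n →
    BestReturn metric α n qₙ → BestReturn metric α (n +ℕ M) qₙ₊ₘ →
    2 *ℕ qₙ ≤ℕ qₙ₊ₘ) →
    ∀ N → 2 ≤ℕ N → g metric α em N ≤ℕ M +ℕ 1)
    ×
    ((∀ n qₙ qₙ₊₁ qₙ₊ₘ → 1 ≤ℕ n →
    BestReturn metric α n qₙ → BestReturn metric α (suc n) qₙ₊₁ →
    BestReturn metric α (n +ℕ M) qₙ₊ₘ →
    qₙ +ℕ qₙ₊₁ ≤ℕ qₙ₊ₘ) →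
    ∀ N → 2 ≤ℕ N → g metric α em N ≤ℕ M +ℕ 1)
theorem2 em X metric α M 1≤M =
  Doubling⇒g-≤ metric α em ,
  λ growth → Doubling⇒g-≤ metric α em (sum-growth⇒Doubling metric α 1≤M growth)
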